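{- Let $T$ be the set of all sentences in the language of ordered rings $(+,-,\cdot,\le,0,1)$ that are true in the ordered ring of integers $\mathbb{Z}$ and have the form $\forall x_1\forall x_2\ldots\forall x_n\exists y\,\phi$, where $\phi$ is an open (quantifier-free) formula. Then $T$ axiomatizes $DOI$: a structure in this language is a model of $T$ if and only if it is a model of $DOI$.
   Context: All formulas are in the language of ordered rings with signature $(+,-,\cdot,\le,0,1)$. A discretely ordered ring is an ordered (commutative, unital) ring with no element strictly between $0$ and $1$. A model of open induction ($OI$) is a discretely ordered ring whose semiring of non-negative elements satisfies the induction axioms for all open (quantifier-free) formulas (with parameters). An ordered ring is diophantine correct if it satisfies every universal sentence (of this language) true in the ordered ring of integers. $DOI$ denotes the theory of diophantine correct models of open induction, i.e. $OI$ together with all universal sentences true in $\mathbb{Z}$. -}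

module Defs where

open import Data.Nat as ℕ using (ℕ; zero; suc)
open import Data.Integer as ℤ using (ℤ)
open import Data.Product using (_×_; Σ; ∃; _,_)
open import Data.Sum using (_⊎_)
open import Data.Unit using (⊤)
open import Data.Empty using (⊥)
open import Relation.Nullary using (¬_)
open import Relation.Binary.PropositionalEquality using (_≡_)

-- Syntax of the language of ordered rings (+, -, ·, ≤, 0, 1).
-- Variables are de Bruijn indices; "-" is read as unary negation.

data Term : Set where
  var    : ℕ → Term
  `0 `1  : Term
  _`+_   : Term → Term → Term
  _`*_   : Term → Term → Term
  `-_    : Term → Term

data Formula : Set where
  `⊤ `⊥  : Formula
  _`≈_   : Term → Term → Formula
  _`≤_   : Term → Term → Formula
  `¬_    : Formula → Formula
  _`∧_   : Formula → Formula → Formula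
  _`∨_   : Formula → Formula → Formula
  _`⇒_   : Formula → Formula → Formula
  `∀_    : Formula → Formula
  `∃_    : Formula → Formula

TermBelow : ℕ → Term → Set
TermBelow n (var i)   = i ℕ.< n
TermBelow n `0        = ⊤
TermBelow n `1        = ⊤
TermBelow n (s `+ t)  = TermBelow n s × TermBelow n t
TermBelow n (s `* t)  = TermBelow n s × TermBelow n t
TermBelow n (`- t)    = TermBelow n t

FreeBelow : ℕ → Formula → Set
FreeBelow n `⊤        = ⊤
FreeBelow n `⊥        = ⊤
FreeBelow n (s `≈ t)  = TermBelow n s × TermBelow n t
FreeBelow n (s `≤ t)  = TermBelow n s × TermBelow n t
FreeBelow n (`¬ φ)    = FreeBelow n φ
FreeBelow n (φ `∧ ψ)  = FreeBelow n φ × FreeBelow n ψ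
FreeBelow n (φ `∨ ψ)  = FreeBelow n φ × FreeBelow n ψ
FreeBelow n (φ `⇒ ψ)  = FreeBelow n φ × FreeBelow n ψ
FreeBelow n (`∀ φ)    = FreeBelow (suc n) φ
FreeBelow n (`∃ φ)    = FreeBelow (suc n) φ

Sentence : Formula → Set
Sentence = FreeBelow 0

Open : Formula → Set
Open `⊤        = ⊤
Open `⊥        = ⊤
Open (s `≈ t)  = ⊤
Open (s `≤ t)  = ⊤
Open (`¬ φ)    = Open φ
Open (φ `∧ ψ)  = Open φ × Open ψ
Open (φ `∨ ψ)  = Open φ × Open ψ
Open (φ `⇒ ψ)  = Open φ × Open ψ
Open (`∀ φ)    = ⊥
Open (`∃ φ)    = ⊥

data Universal : Formula → Set where
  open-u : ∀ {φ} → Open φ → Universal φ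
  all-u  : ∀ {φ} → Universal φ → Universal (`∀ φ)

data ForallExists : Formula → Set where
  ex-ae  : ∀ {φ} → Open φ → ForallExists (`∃ φ)
  all-ae : ∀ {φ} → ForallExists φ → ForallExists (`∀ φ)

record Structure : Set₁ where
  field
    Carrier : Set
    0ᴹ 1ᴹ   : Carrier
    _+ᴹ_    : Carrier → Carrier → Carrier
    _*ᴹ_    : Carrier → Carrier → Carrier
    -ᴹ_     : Carrier → Carrier
    _≤ᴹ_    : Carrier → Carrier → Set

module _ (M : Structure) where
  open Structure M

  Env : Set
  Env = ℕ → Carrier

  _∷ₑ_ : Carrier → Env → Env
  (a ∷ₑ ρ) zero    = a
  (a ∷ₑ ρ) (suc i) = ρ i

  evalT : Env → Term → Carrier
  evalT ρ (var i)  = ρ i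
  evalT ρ `0       = 0ᴹ
  evalT ρ `1       = 1ᴹ
  evalT ρ (s `+ t) = evalT ρ s +ᴹ evalT ρ t
  evalT ρ (s `* t) = evalT ρ s *ᴹ evalT ρ t
  evalT ρ (`- t)   = -ᴹ evalT ρ t

  Sat : Env → Formula → Set
  Sat ρ `⊤       = ⊤
  Sat ρ `⊥       = ⊥
  Sat ρ (s `≈ t) = evalT ρ s ≡ evalT ρ t
  Sat ρ (s `≤ t) = evalT ρ s ≤ᴹ evalT ρ t
  Sat ρ (`¬ φ)   = ¬ Sat ρ φ
  Sat ρ (φ `∧ ψ) = Sat ρ φ × Sat ρ ψ
  Sat ρ (φ `∨ ψ) = Sat ρ φ ⊎ Sat ρ ψ
  Sat ρ (φ `⇒ ψ) = Sat ρ φ → Sat ρ ψ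
  Sat ρ (`∀ φ)   = (a : Carrier) → Sat (a ∷ₑ ρ) φ
  Sat ρ (`∃ φ)   = Σ Carrier λ a → Sat (a ∷ₑ ρ) φ

_⊨_ : Structure → Formula → Set
M ⊨ φ = (ρ : Env M) → Sat M ρ φ

ℤ-str : Structure
ℤ-str = record
  { Carrier = ℤ ; 0ᴹ = ℤ.0ℤ ; 1ᴹ = ℤ.1ℤ
  ; _+ᴹ_ = ℤ._+_ ; _*ᴹ_ = ℤ._*_ ; -ᴹ_ = ℤ.-_ ; _≤ᴹ_ = ℤ._≤_ }

record IsDiscretelyOrderedRing (M : Structure) : Set where
  open Structure M
  _<ᴹ_ : Carrier → Carrier → Set
  x <ᴹ y = (x ≤ᴹ y) × ¬ (x ≡ y)
  field
    +-assoc   : ∀ x y z → (x +ᴹ y) +ᴹ z ≡ x +ᴹ (y +ᴹ z)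
    +-comm    : ∀ x y → x +ᴹ y ≡ y +ᴹ x
    +-identity : ∀ x → x +ᴹ 0ᴹ ≡ x
    +-inverse : ∀ x → x +ᴹ (-ᴹ x) ≡ 0ᴹ
    *-assoc   : ∀ x y z → (x *ᴹ y) *ᴹ z ≡ x *ᴹ (y *ᴹ z)
    *-comm    : ∀ x y → x *ᴹ y ≡ y *ᴹ x
    *-identity : ∀ x → x *ᴹ 1ᴹ ≡ x
    distrib   : ∀ x y z → x *ᴹ (y +ᴹ z) ≡ (x *ᴹ y) +ᴹ (x *ᴹ z)
    ≤-refl    : ∀ x → x ≤ᴹ x
    ≤-antisym : ∀ x y → x ≤ᴹ y → y ≤ᴹ x → x ≡ y
    ≤-trans   : ∀ x y z → x ≤ᴹ y → y ≤ᴹ z → x ≤ᴹ z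
    ≤-total   : ∀ x y → (x ≤ᴹ y) ⊎ (y ≤ᴹ x)
    +-mono-≤  : ∀ x y z → x ≤ᴹ y → (x +ᴹ z) ≤ᴹ (y +ᴹ z)
    *-nonneg  : ∀ x y → 0ᴹ ≤ᴹ x → 0ᴹ ≤ᴹ y → 0ᴹ ≤ᴹ (x *ᴹ y)
    0≢1       : ¬ (0ᴹ ≡ 1ᴹ)
    discrete  : ∀ x → ¬ ((0ᴹ <ᴹ x) × (x <ᴹ 1ᴹ))

OpenInduction : Structure → Set
OpenInduction M =
  (φ : Formula) → Open φ → (ρ : Env M) →
  Sat M (0ᴹ ∷ ρ) φ →
  ((x : Carrier) → 0ᴹ ≤ᴹ x → Sat M (x ∷ ρ) φ → Sat M ((x +ᴹ 1ᴹ) ∷ ρ) φ) →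
  (x : Carrier) → 0ᴹ ≤ᴹ x → Sat M (x ∷ ρ) φ
  where open Structure M
        infixr 5 _∷_
        _∷_ : Carrier → Env M → Env M
        _∷_ = _∷ₑ_ M

IsOI : Structure → Set
IsOI M = IsDiscretelyOrderedRing M × OpenInduction M

DiophantineCorrect : Structure → Set
DiophantineCorrect M =
  (φ : Formula) → Sentence φ → Universal φ → ℤ-str ⊨ φ → M ⊨ φ

IsDOI : Structure → Set
IsDOI M = IsOI M × DiophantineCorrect M

ModelOfT : Structure → Set
ModelOfT M =
  (φ : Formula) → Sentence φ → ForallExists φ → ℤ-str ⊨ φ → M ⊨ φ

{-# OPTIONS --safe #-}
-- That models of T are models of DOI: a universal sentence is a ∀∃-sentence with a dummy y, and
-- the failure of an instance of open induction produces a y with φ(y) and ¬φ(y+1).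
--
-- Conversely, let ∀x∃y φ hold in ℤ and suppose that φ(a, y) fails for all y in M ⊨ DOI; replacing
-- φ(y) by φ(y) ∨ φ(−y), only y ≥ 0 matter. The truth of φ(a, y) depends on the signs of finitely
-- many polynomials in y. Take them together with all their iterated finite differences. If each
-- of these has equal signs at the two ends of an interval of ℤ, then each has constant sign on
-- it, by induction on the degree: if Δp has constant sign then p is monotone. Hence constancy of
-- all the signs is an open condition on the end points, and similarly for half-lines. Open
-- induction in M cuts [0, ∞) into finitely many such intervals, where the end of each is the last
-- point before a sign changes; all other facts needed in M are universal and come from ℤ. The
-- existence of end points such that φ fails on each interval is then an existential statement
-- true in M, so that it holds in ℤ for some x. There it refutes ∃y φ(x, y).
module Submission where

open import Defs
open import Level using (0ℓ)
open import Axiom.ExcludedMiddle using (ExcludedMiddle)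
open import Data.Nat as ℕ using (ℕ; zero; suc; z≤n; s≤s)
import Data.Nat.Properties as ℕₚ
open import Data.Integer as ℤ using (ℤ; +_; 0ℤ; 1ℤ; -1ℤ)
import Data.Integer.Properties as ℤₚ
open import Data.Integer.Tactic.RingSolver using (solve-∀)
open import Data.List using (List; []; _∷_; _++_; length)
open import Data.List.Membership.Propositional using (_∈_)
open import Data.List.Relation.Unary.Any using (here)
open import Data.List.Relation.Unary.All as All using (All; []; _∷_)
import Data.List.Relation.Unary.All.Properties as Allₚ
open import Data.Product using (_×_; ∃; _,_; proj₁; proj₂)
open import Data.Product.Function.NonDependent.Propositional using (_×-⇔_)
open import Data.Sum using (_⊎_; inj₁; inj₂; [_,_]′)
open import Data.Sum.Function.Propositional using (_⊎-⇔_)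
open import Data.Unit using (tt)
open import Data.Empty using (⊥; ⊥-elim)
open import Function using (_⇔_; mk⇔; Equivalence; _∘_; const)
open import Function.Construct.Identity using (⇔-id)
open import Relation.Nullary using (¬_; yes; no)
open import Relation.Nullary.Decidable using (decidable-stable)
open import Relation.Binary.Definitions using (Tri; tri<; tri≈; tri>)
open import Relation.Binary.PropositionalEquality
  using (_≡_; refl; sym; trans; cong; cong₂; subst; subst₂)

open Equivalence using (to; from)

-- Substitution and its semantics

substT : (ℕ → Term) → Term → Term
substT σ (var i)  = σ i
substT σ `0       = `0
substT σ `1       = `1
substT σ (s `+ t) = substT σ s `+ substT σ t
substT σ (s `* t) = substT σ s `* substT σ t
substT σ (`- t)   = `- substT σ t

-- Meaningful on open formulas only.
substF : (ℕ → Term) → Formula → Formula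
substF σ `⊤       = `⊤
substF σ `⊥       = `⊥
substF σ (s `≈ t) = substT σ s `≈ substT σ t
substF σ (s `≤ t) = substT σ s `≤ substT σ t
substF σ (`¬ φ)   = `¬ substF σ φ
substF σ (φ `∧ ψ) = substF σ φ `∧ substF σ ψ
substF σ (φ `∨ ψ) = substF σ φ `∨ substF σ ψ
substF σ (φ `⇒ ψ) = substF σ φ `⇒ substF σ ψ
substF σ (`∀ φ)   = `∀ φ
substF σ (`∃ φ)   = `∃ φ

substF-open : ∀ σ φ → Open φ → Open (substF σ φ)
substF-open σ `⊤       o         = tt
substF-open σ `⊥       o         = tt
substF-open σ (s `≈ t) o         = tt
substF-open σ (s `≤ t) o         = tt
substF-open σ (`¬ φ)   o         = substF-open σ φ o
substF-open σ (φ `∧ ψ) (o₁ , o₂) = substF-open σ φ o₁ , substF-open σ ψ o₂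
substF-open σ (φ `∨ ψ) (o₁ , o₂) = substF-open σ φ o₁ , substF-open σ ψ o₂
substF-open σ (φ `⇒ ψ) (o₁ , o₂) = substF-open σ φ o₁ , substF-open σ ψ o₂

drop : ∀ {A : Set} → ℕ → (ℕ → A) → (ℕ → A)
drop k e i = e (k ℕ.+ i)

-- Substitutes a for variable 0, the remaining variables being found from index k on.
inst : ℕ → Term → ℕ → Term
inst k a zero    = a
inst k a (suc i) = var (k ℕ.+ i)

atT : ℕ → Term → Term → Term
atT k a = substT (inst k a)

atF : ℕ → Term → Formula → Formula
atF k a = substF (inst k a)

→-⇔ : ∀ {A B C D : Set} → A ⇔ B → C ⇔ D → (A → C) ⇔ (B → D)
→-⇔ f g = mk⇔ (λ h → to g ∘ h ∘ from f) (λ h → from g ∘ h ∘ to f)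

¬-⇔ : ∀ {A B : Set} → A ⇔ B → (¬ A) ⇔ (¬ B)
¬-⇔ f = →-⇔ f (⇔-id ⊥)

≡⇒⇔ : ∀ {A B : Set} → A ≡ B → A ⇔ B
≡⇒⇔ refl = ⇔-id _

module _ (M : Structure) where
  open Structure M

  eval-subst : ∀ {σ} {e ρ : Env M} → (∀ i → evalT M e (σ i) ≡ ρ i) →
               ∀ t → evalT M e (substT σ t) ≡ evalT M ρ t
  eval-subst h (var i)  = h i
  eval-subst h `0       = refl
  eval-subst h `1       = refl
  eval-subst h (s `+ t) = cong₂ _+ᴹ_ (eval-subst h s) (eval-subst h t)
  eval-subst h (s `* t) = cong₂ _*ᴹ_ (eval-subst h s) (eval-subst h t)
  eval-subst h (`- t)   = cong -ᴹ_ (eval-subst h t)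

  eval-cong : ∀ {e ρ : Env M} → (∀ i → e i ≡ ρ i) → ∀ t → evalT M e t ≡ evalT M ρ t
  eval-cong h (var i)  = h i
  eval-cong h `0       = refl
  eval-cong h `1       = refl
  eval-cong h (s `+ t) = cong₂ _+ᴹ_ (eval-cong h s) (eval-cong h t)
  eval-cong h (s `* t) = cong₂ _*ᴹ_ (eval-cong h s) (eval-cong h t)
  eval-cong h (`- t)   = cong -ᴹ_ (eval-cong h t)

  Sat-subst : ∀ {σ} {e ρ : Env M} → (∀ i → evalT M e (σ i) ≡ ρ i) →
              ∀ φ → Open φ → Sat M e (substF σ φ) ⇔ Sat M ρ φ
  Sat-subst h `⊤       o = ⇔-id _
  Sat-subst h `⊥       o = ⇔-id _
  Sat-subst h (s `≈ t) o = ≡⇒⇔ (cong₂ _≡_ (eval-subst h s) (eval-subst h t))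
  Sat-subst h (s `≤ t) o = ≡⇒⇔ (cong₂ _≤ᴹ_ (eval-subst h s) (eval-subst h t))
  Sat-subst h (`¬ φ)   o = ¬-⇔ (Sat-subst h φ o)
  Sat-subst h (φ `∧ ψ) (o₁ , o₂) = Sat-subst h φ o₁ ×-⇔ Sat-subst h ψ o₂
  Sat-subst h (φ `∨ ψ) (o₁ , o₂) = Sat-subst h φ o₁ ⊎-⇔ Sat-subst h ψ o₂
  Sat-subst h (φ `⇒ ψ) (o₁ , o₂) = →-⇔ (Sat-subst h φ o₁) (Sat-subst h ψ o₂)

  ∷-cong : ∀ {e ρ : Env M} → (∀ i → e i ≡ ρ i) → ∀ a i → _∷ₑ_ M a e i ≡ _∷ₑ_ M a ρ i
  ∷-cong h a zero    = refl
  ∷-cong h a (suc i) = h i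

  -- Without function extensionality, pointwise equal environments are not known to be equal;
  -- `∀-strip` meets such a pair.
  Sat-cong : ∀ {e ρ : Env M} → (∀ i → e i ≡ ρ i) → ∀ φ → Sat M e φ ⇔ Sat M ρ φ
  Sat-cong h `⊤       = ⇔-id _
  Sat-cong h `⊥       = ⇔-id _
  Sat-cong h (s `≈ t) = ≡⇒⇔ (cong₂ _≡_ (eval-cong h s) (eval-cong h t))
  Sat-cong h (s `≤ t) = ≡⇒⇔ (cong₂ _≤ᴹ_ (eval-cong h s) (eval-cong h t))
  Sat-cong h (`¬ φ)   = ¬-⇔ (Sat-cong h φ)
  Sat-cong h (φ `∧ ψ) = Sat-cong h φ ×-⇔ Sat-cong h ψ
  Sat-cong h (φ `∨ ψ) = Sat-cong h φ ⊎-⇔ Sat-cong h ψ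
  Sat-cong h (φ `⇒ ψ) = →-⇔ (Sat-cong h φ) (Sat-cong h ψ)
  Sat-cong h (`∀ φ)   = mk⇔ (λ s a → to (Sat-cong (∷-cong h a) φ) (s a))
                            (λ s a → from (Sat-cong (∷-cong h a) φ) (s a))
  Sat-cong h (`∃ φ)   = mk⇔ (λ (a , s) → a , to (Sat-cong (∷-cong h a) φ) s)
                            (λ (a , s) → a , from (Sat-cong (∷-cong h a) φ) s)

  eval-inst : ∀ k a (e : Env M) i →
              evalT M e (inst k a i) ≡ _∷ₑ_ M (evalT M e a) (drop k e) i
  eval-inst k a e zero    = refl
  eval-inst k a e (suc i) = refl

  eval-atT : ∀ k a e t →
             evalT M e (atT k a t) ≡ evalT M (_∷ₑ_ M (evalT M e a) (drop k e)) t
  eval-atT k a e = eval-subst (eval-inst k a e)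

  Sat-atF : ∀ k a e φ → Open φ →
            Sat M e (atF k a φ) ⇔ Sat M (_∷ₑ_ M (evalT M e a) (drop k e)) φ
  Sat-atF k a e = Sat-subst (eval-inst k a e)

-- Bounds on free variables

TermBelow-mono : ∀ {m n} → m ℕ.≤ n → ∀ t → TermBelow m t → TermBelow n t
TermBelow-mono m≤n (var i)  b         = ℕₚ.≤-trans b m≤n
TermBelow-mono m≤n `0       b         = tt
TermBelow-mono m≤n `1       b         = tt
TermBelow-mono m≤n (s `+ t) (b₁ , b₂) = TermBelow-mono m≤n s b₁ , TermBelow-mono m≤n t b₂
TermBelow-mono m≤n (s `* t) (b₁ , b₂) = TermBelow-mono m≤n s b₁ , TermBelow-mono m≤n t b₂
TermBelow-mono m≤n (`- t)   b         = TermBelow-mono m≤n t b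

FreeBelow-mono : ∀ {m n} → m ℕ.≤ n → ∀ φ → FreeBelow m φ → FreeBelow n φ
FreeBelow-mono m≤n `⊤       b         = tt
FreeBelow-mono m≤n `⊥       b         = tt
FreeBelow-mono m≤n (s `≈ t) (b₁ , b₂) = TermBelow-mono m≤n s b₁ , TermBelow-mono m≤n t b₂
FreeBelow-mono m≤n (s `≤ t) (b₁ , b₂) = TermBelow-mono m≤n s b₁ , TermBelow-mono m≤n t b₂
FreeBelow-mono m≤n (`¬ φ)   b         = FreeBelow-mono m≤n φ b
FreeBelow-mono m≤n (φ `∧ ψ) (b₁ , b₂) = FreeBelow-mono m≤n φ b₁ , FreeBelow-mono m≤n ψ b₂
FreeBelow-mono m≤n (φ `∨ ψ) (b₁ , b₂) = FreeBelow-mono m≤n φ b₁ , FreeBelow-mono m≤n ψ b₂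
FreeBelow-mono m≤n (φ `⇒ ψ) (b₁ , b₂) = FreeBelow-mono m≤n φ b₁ , FreeBelow-mono m≤n ψ b₂
FreeBelow-mono m≤n (`∀ φ)   b         = FreeBelow-mono (s≤s m≤n) φ b
FreeBelow-mono m≤n (`∃ φ)   b         = FreeBelow-mono (s≤s m≤n) φ b

below-⊔ : ∀ {P Q : ℕ → Set} → (∀ {m n} → m ℕ.≤ n → P m → P n) →
          (∀ {m n} → m ℕ.≤ n → Q m → Q n) → ∃ P → ∃ Q → ∃ λ n → P n × Q n
below-⊔ P↑ Q↑ (m , p) (n , q) = m ℕ.⊔ n , P↑ (ℕₚ.m≤m⊔n m n) p , Q↑ (ℕₚ.m≤n⊔m m n) q

term-below : ∀ t → ∃ λ n → TermBelow n t
terms-below : ∀ s t → ∃ λ n → TermBelow n s × TermBelow n t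
term-below (var i)  = suc i , ℕₚ.≤-refl
term-below `0       = 0 , tt
term-below `1       = 0 , tt
term-below (s `+ t) = terms-below s t
term-below (s `* t) = terms-below s t
term-below (`- t)   = term-below t
terms-below s t = below-⊔ (λ le → TermBelow-mono le s) (λ le → TermBelow-mono le t)
                          (term-below s) (term-below t)

free-below : ∀ φ → ∃ λ n → FreeBelow n φ
frees-below : ∀ φ ψ → ∃ λ n → FreeBelow n φ × FreeBelow n ψ
free-below `⊤       = 0 , tt
free-below `⊥       = 0 , tt
free-below (s `≈ t) = terms-below s t
free-below (s `≤ t) = terms-below s t
free-below (`¬ φ)   = free-below φ
free-below (φ `∧ ψ) = frees-below φ ψ
free-below (φ `∨ ψ) = frees-below φ ψ
free-below (φ `⇒ ψ) = frees-below φ ψ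
free-below (`∀ φ)   = let n , b = free-below φ in n , FreeBelow-mono (ℕₚ.n≤1+n n) φ b
free-below (`∃ φ)   = let n , b = free-below φ in n , FreeBelow-mono (ℕₚ.n≤1+n n) φ b
frees-below φ ψ = below-⊔ (λ le → FreeBelow-mono le φ) (λ le → FreeBelow-mono le ψ)
                          (free-below φ) (free-below ψ)

-- Universal closure and inheritance of truth from ℤ

∀ⁿ : ℕ → Formula → Formula
∀ⁿ zero    φ = φ
∀ⁿ (suc n) φ = `∀ ∀ⁿ n φ

∀ⁿ-below : ∀ m n φ → FreeBelow (n ℕ.+ m) φ → FreeBelow m (∀ⁿ n φ)
∀ⁿ-below m zero    φ b = b
∀ⁿ-below m (suc n) φ b =
  ∀ⁿ-below (suc m) n φ (subst (λ k → FreeBelow k φ) (sym (ℕₚ.+-suc n m)) b)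

∀ⁿ-universal : ∀ n φ → Open φ → Universal (∀ⁿ n φ)
∀ⁿ-universal zero    φ o = open-u o
∀ⁿ-universal (suc n) φ o = all-u (∀ⁿ-universal n φ o)

∀ⁿ∃-forallExists : ∀ n φ → Open φ → ForallExists (∀ⁿ n (`∃ φ))
∀ⁿ∃-forallExists zero    φ o = ex-ae o
∀ⁿ∃-forallExists (suc n) φ o = all-ae (∀ⁿ∃-forallExists n φ o)

∀-strip : ∀ M φ → M ⊨ (`∀ φ) → M ⊨ φ
-- The environment `ρ` agrees pointwise with `ρ 0` put before its tail.
∀-strip M φ h ρ = to (Sat-cong M (λ { zero → refl ; (suc i) → refl }) φ) (h (drop 1 ρ) (ρ 0))

∀ⁿ-strip : ∀ M n φ → M ⊨ ∀ⁿ n φ → M ⊨ φ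
∀ⁿ-strip M zero    φ h = h
∀ⁿ-strip M (suc n) φ h = ∀ⁿ-strip M n φ (∀-strip M (∀ⁿ n φ) h)

∀ⁿ-intro : ∀ M n φ → M ⊨ φ → M ⊨ ∀ⁿ n φ
∀ⁿ-intro M zero    φ h ρ   = h ρ
∀ⁿ-intro M (suc n) φ h ρ a = ∀ⁿ-intro M n φ h (_∷ₑ_ M a ρ)

-- Validity under all environments stands for the universal closure, so that neither a quantifier
-- prefix nor closedness has to be carried along.
Inherits∀ Inherits∀∃ : Structure → Set
Inherits∀  M = ∀ φ → Open φ → ℤ-str ⊨ φ → M ⊨ φ
Inherits∀∃ M = ∀ φ → Open φ → ℤ-str ⊨ (`∃ φ) → M ⊨ (`∃ φ)

diophantineCorrect⇒inherits∀ : ∀ M → DiophantineCorrect M → Inherits∀ M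
diophantineCorrect⇒inherits∀ M dc φ o h =
  let n , b = free-below φ in
  ∀ⁿ-strip M n φ (dc (∀ⁿ n φ)
    (∀ⁿ-below 0 n φ (subst (λ k → FreeBelow k φ) (sym (ℕₚ.+-identityʳ n)) b))
    (∀ⁿ-universal n φ o) (∀ⁿ-intro ℤ-str n φ h))

inherits∀⇒diophantineCorrect : ∀ M → Inherits∀ M → DiophantineCorrect M
inherits∀⇒diophantineCorrect M r φ _ = go φ
  where
  go : ∀ φ → Universal φ → ℤ-str ⊨ φ → M ⊨ φ
  go φ        (open-u o) h = r φ o h
  go (`∀ φ)   (all-u u)  h = λ ρ a → go φ u (∀-strip ℤ-str φ h) (_∷ₑ_ M a ρ)

modelOfT⇒inherits∀∃ : ∀ M → ModelOfT M → Inherits∀∃ M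
modelOfT⇒inherits∀∃ M mt φ o h =
  let n , b = free-below (`∃ φ) in
  ∀ⁿ-strip M n (`∃ φ) (mt (∀ⁿ n (`∃ φ))
    (∀ⁿ-below 0 n (`∃ φ) (subst (λ k → FreeBelow k (`∃ φ)) (sym (ℕₚ.+-identityʳ n)) b))
    (∀ⁿ∃-forallExists n φ o) (∀ⁿ-intro ℤ-str n (`∃ φ) h))

inherits∀∃⇒modelOfT : ∀ M → Inherits∀∃ M → ModelOfT M
inherits∀∃⇒modelOfT M r φ _ = go φ
  where
  go : ∀ φ → ForallExists φ → ℤ-str ⊨ φ → M ⊨ φ
  go (`∃ φ) (ex-ae o)  h = r φ o h
  go (`∀ φ) (all-ae u) h = λ ρ a → go φ u (∀-strip ℤ-str φ h) (_∷ₑ_ M a ρ)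

-- All variables are shifted up by one, so that the added existential quantifier binds no occurrence
-- and 0 may serve as its witness in ℤ.
inherits∀∃⇒inherits∀ : ∀ M → Inherits∀∃ M → Inherits∀ M
inherits∀∃⇒inherits∀ M r φ o h ρ =
  to (Sat-subst M (λ _ → refl) φ o) (proj₂ (r φ↑ (substF-open _ φ o)
    (λ ρ → 0ℤ , from (Sat-subst ℤ-str (λ _ → refl) φ o) (h ρ)) ρ))
  where φ↑ = substF (var ∘ suc) φ

-- Models of T are models of DOI

infixr 5 _◂ᶻ_

_◂ᶻ_ : ℤ → Env ℤ-str → Env ℤ-str
_◂ᶻ_ = _∷ₑ_ ℤ-str

ℤ-induction : ∀ (P : ℤ → Set) u → P u → (∀ y → u ℤ.≤ y → P y → P (y ℤ.+ 1ℤ)) →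
              ∀ y → u ℤ.≤ y → P y
ℤ-induction P u base step y u≤y =
  subst P (trans (cong (λ k → u ℤ.+ k) (ℤₚ.0≤i⇒+∣i∣≡i (ℤₚ.i≤j⇒0≤j-i u≤y))) (u+[y-u] u y))
    (go ℤ.∣ y ℤ.- u ∣)
  where
  u+[y-u] : ∀ u y → u ℤ.+ (y ℤ.- u) ≡ y
  u+[y-u] = solve-∀
  assoc1 : ∀ u n → u ℤ.+ n ℤ.+ 1ℤ ≡ u ℤ.+ (1ℤ ℤ.+ n)
  assoc1 = solve-∀
  go : ∀ n → P (u ℤ.+ + n)
  go zero    = subst P (sym (ℤₚ.+-identityʳ u)) base
  go (suc n) = subst P (assoc1 u (+ n)) (step (u ℤ.+ + n) (ℤₚ.i≤i+j u (+ n)) (go n))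

module _ (M : Structure) (univ : Inherits∀ M) where
  open Structure M

  private
    infixr 5 _◂_
    _◂_ : Carrier → Env M → Env M
    _◂_ = _∷ₑ_ M

    env : Carrier → Carrier → Carrier → Env M
    env a b c = a ◂ b ◂ c ◂ λ _ → 0ᴹ

    x y z : Term
    x = var 0
    y = var 1
    z = var 2

  -- Each axiom is the universal closure of an open formula that holds in ℤ.
  inherits∀⇒discretelyOrderedRing : IsDiscretelyOrderedRing M
  inherits∀⇒discretelyOrderedRing = record
    { +-assoc    = λ a b c → univ (((x `+ y) `+ z) `≈ (x `+ (y `+ z))) tt
                     (λ ρ → ℤₚ.+-assoc (ρ 0) (ρ 1) (ρ 2)) (env a b c)
    ; +-comm     = λ a b → univ ((x `+ y) `≈ (y `+ x)) tt
                     (λ ρ → ℤₚ.+-comm (ρ 0) (ρ 1)) (env a b b)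
    ; +-identity = λ a → univ ((x `+ `0) `≈ x) tt (λ ρ → ℤₚ.+-identityʳ (ρ 0)) (env a a a)
    ; +-inverse  = λ a → univ ((x `+ (`- x)) `≈ `0) tt (λ ρ → ℤₚ.+-inverseʳ (ρ 0)) (env a a a)
    ; *-assoc    = λ a b c → univ (((x `* y) `* z) `≈ (x `* (y `* z))) tt
                     (λ ρ → ℤₚ.*-assoc (ρ 0) (ρ 1) (ρ 2)) (env a b c)
    ; *-comm     = λ a b → univ ((x `* y) `≈ (y `* x)) tt
                     (λ ρ → ℤₚ.*-comm (ρ 0) (ρ 1)) (env a b b)
    ; *-identity = λ a → univ ((x `* `1) `≈ x) tt (λ ρ → ℤₚ.*-identityʳ (ρ 0)) (env a a a)
    ; distrib    = λ a b c → univ ((x `* (y `+ z)) `≈ ((x `* y) `+ (x `* z))) tt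
                     (λ ρ → ℤₚ.*-distribˡ-+ (ρ 0) (ρ 1) (ρ 2)) (env a b c)
    ; ≤-refl     = λ a → univ (x `≤ x) tt (λ ρ → ℤₚ.≤-refl) (env a a a)
    ; ≤-antisym  = λ a b → univ ((x `≤ y) `⇒ ((y `≤ x) `⇒ (x `≈ y))) _
                     (λ ρ → ℤₚ.≤-antisym) (env a b b)
    ; ≤-trans    = λ a b c → univ ((x `≤ y) `⇒ ((y `≤ z) `⇒ (x `≤ z))) _
                     (λ ρ → ℤₚ.≤-trans) (env a b c)
    ; ≤-total    = λ a b → univ ((x `≤ y) `∨ (y `≤ x)) _
                     (λ ρ → ℤₚ.≤-total (ρ 0) (ρ 1)) (env a b b)
    ; +-mono-≤   = λ a b c → univ ((x `≤ y) `⇒ ((x `+ z) `≤ (y `+ z))) _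
                     (λ ρ → ℤₚ.+-monoˡ-≤ (ρ 2)) (env a b c)
    ; *-nonneg   = λ a b → univ ((`0 `≤ x) `⇒ ((`0 `≤ y) `⇒ (`0 `≤ (x `* y)))) _
                     (λ ρ → ℤ-*-nonneg) (env a b b)
    ; 0≢1        = univ (`¬ (`0 `≈ `1)) tt (λ ρ ()) (env 0ᴹ 0ᴹ 0ᴹ)
    ; discrete   = λ a → univ (`¬ (((`0 `≤ x) `∧ (`¬ (`0 `≈ x))) `∧
                                   ((x `≤ `1) `∧ (`¬ (x `≈ `1))))) _
                     (λ ρ → ℤ-discrete) (env a a a)
    }
    where
    ℤ-*-nonneg : ∀ {i j} → 0ℤ ℤ.≤ i → 0ℤ ℤ.≤ j → 0ℤ ℤ.≤ i ℤ.* j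
    ℤ-*-nonneg {+ m} {+ n} _ _ = subst (λ k → 0ℤ ℤ.≤ k) (ℤₚ.pos-* m n) (ℤ.+≤+ z≤n)

    ℤ-discrete : ∀ {i} → ¬ ((0ℤ ℤ.≤ i × ¬ 0ℤ ≡ i) × (i ℤ.≤ 1ℤ × ¬ i ≡ 1ℤ))
    ℤ-discrete ((0≤i , 0≢i) , (i≤1 , i≢1)) =
      ℤₚ.<⇒≱ (ℤₚ.≤∧≢⇒< i≤1 i≢1) (ℤₚ.i<j⇒suc[i]≤j (ℤₚ.≤∧≢⇒< 0≤i 0≢i))

-- Induction for φ at x with parameters ρ is the sentence
-- ∀ρ ∀x ∃y (0 ≤ x ∧ φ(0) ∧ ¬φ(x) → 0 ≤ y ∧ φ(y) ∧ ¬φ(y+1)).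
inherits∀∃⇒openInduction : ExcludedMiddle 0ℓ → ∀ M → Inherits∀∃ M → OpenInduction M
inherits∀∃⇒openInduction em M inh φ o ρ base step a 0≤a = decidable-stable em λ ¬φa →
  let b , h = inh χ χ-open χ-true (_∷ₑ_ M a ρ)
      e = _∷ₑ_ M b (_∷ₑ_ M a ρ)
      0≤b , φb , ¬φb+1 = h (0≤a , from (Sat-atF M 2 `0 e φ o) base ,
                            ¬φa ∘ to (Sat-atF M 2 (var 1) e φ o))
  in ¬φb+1 (from (Sat-atF M 2 (var 0 `+ `1) e φ o)
             (step b 0≤b (to (Sat-atF M 2 (var 0) e φ o) φb)))
  where
  χ : Formula
  χ = ((`0 `≤ var 1) `∧ (atF 2 `0 φ `∧ (`¬ atF 2 (var 1) φ))) `⇒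
      ((`0 `≤ var 0) `∧ (atF 2 (var 0) φ `∧ (`¬ atF 2 (var 0 `+ `1) φ)))

  χ-open : Open χ
  χ-open = (tt , substF-open _ φ o , substF-open _ φ o) ,
           (tt , substF-open _ φ o , substF-open _ φ o)

  χ-true : ℤ-str ⊨ (`∃ χ)
  χ-true ρ = decidable-stable em λ none →
    -- Without a witness, φ(y) always passes on to φ(y+1) for y ≥ 0, so induction in ℤ proves φ(x)
    -- against the premise of `χ`; then y = 0 is a witness after all.
    none (0ℤ , λ (0≤x , φ0 , ¬φx) → ⊥-elim (¬φx (at⁻ (var 1) 0ℤ
      (ℤ-induction (λ y → Sat ℤ-str (y ◂ᶻ drop 1 ρ) φ) 0ℤ (at⁺ `0 0ℤ φ0)
        (λ y 0≤y φy → decidable-stable em λ ¬φy+1 →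
          none (y , λ _ → 0≤y , at⁻ (var 0) y φy , ¬φy+1 ∘ at⁺ (var 0 `+ `1) y))
        (ρ 0) 0≤x))))
    where
    at⁺ : ∀ a y → let e = y ◂ᶻ ρ in Sat ℤ-str e (atF 2 a φ) →
          Sat ℤ-str ((evalT ℤ-str e a) ◂ᶻ drop 1 ρ) φ
    at⁺ a y = to (Sat-atF ℤ-str 2 a (y ◂ᶻ ρ) φ o)
    at⁻ : ∀ a y → let e = y ◂ᶻ ρ in
          Sat ℤ-str ((evalT ℤ-str e a) ◂ᶻ drop 1 ρ) φ → Sat ℤ-str e (atF 2 a φ)
    at⁻ a y = from (Sat-atF ℤ-str 2 a (y ◂ᶻ ρ) φ o)

modelOfT⇒DOI : ExcludedMiddle 0ℓ → ∀ M → ModelOfT M → IsDOI M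
modelOfT⇒DOI em M mt =
  (inherits∀⇒discretelyOrderedRing M inh∀ , inherits∀∃⇒openInduction em M inh∀∃) ,
  inherits∀⇒diophantineCorrect M inh∀
  where
  inh∀∃ = modelOfT⇒inherits∀∃ M mt
  inh∀  = inherits∀∃⇒inherits∀ M inh∀∃

-- Finite differences

Δ : Term → Term
Δ t = atT 1 (var 0 `+ `1) t `+ (`- t)

δ : (ℤ → ℤ) → ℤ → ℤ
δ f y = f (y ℤ.+ 1ℤ) ℤ.- f y

-- The n-th difference vanishes identically; for a polynomial this says that its degree is less than
-- n.
DegreeBelow : ℕ → (ℤ → ℤ) → Set
DegreeBelow zero    f = ∀ y → f y ≡ 0ℤ
DegreeBelow (suc n) f = DegreeBelow n (δ f)

degree-cong : ∀ n {f g} → (∀ y → f y ≡ g y) → DegreeBelow n f → DegreeBelow n g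
degree-cong zero    h d y = trans (sym (h y)) (d y)
degree-cong (suc n) h     = degree-cong n (λ y → cong₂ ℤ._-_ (h (y ℤ.+ 1ℤ)) (h y))

degree-zero : ∀ n {f} → (∀ y → f y ≡ 0ℤ) → DegreeBelow n f
degree-zero zero    z = z
degree-zero (suc n) z = degree-zero n (λ y → cong₂ ℤ._-_ (z (y ℤ.+ 1ℤ)) (z y))

degree-mono : ∀ {m n} → m ℕ.≤ n → ∀ {f} → DegreeBelow m f → DegreeBelow n f
degree-mono {n = n} z≤n d = degree-zero n d
degree-mono (s≤s m≤n)   d = degree-mono m≤n d

degree-+ : ∀ n {f g} → DegreeBelow n f → DegreeBelow n g → DegreeBelow n (λ y → f y ℤ.+ g y)
degree-+ zero            c d y = cong₂ ℤ._+_ (c y) (d y)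
degree-+ (suc n) {f} {g} c d   =
  degree-cong n (λ y → rearrange (f (y ℤ.+ 1ℤ)) (f y) (g (y ℤ.+ 1ℤ)) (g y)) (degree-+ n c d)
  where
  rearrange : ∀ a b c d → a ℤ.- b ℤ.+ (c ℤ.- d) ≡ a ℤ.+ c ℤ.- (b ℤ.+ d)
  rearrange = solve-∀

degree-neg : ∀ n {f} → DegreeBelow n f → DegreeBelow n (λ y → ℤ.- f y)
degree-neg zero        d y = cong ℤ.-_ (d y)
degree-neg (suc n) {f} d   =
  degree-cong n (λ y → ℤₚ.neg-distrib-+ (f (y ℤ.+ 1ℤ)) (ℤ.- f y)) (degree-neg n d)

degree-shift : ∀ n {f} → DegreeBelow n f → DegreeBelow n (λ y → f (y ℤ.+ 1ℤ))
degree-shift zero    d y = d (y ℤ.+ 1ℤ)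
degree-shift (suc n) d   = degree-shift n d

-- By the product rule δ(fg)(y) = f(y+1)·δg(y) + δf(y)·g(y), each summand has one of the two bounds
-- lowered. The bound is not sharp; m + n - 1 would involve truncated subtraction.
degree-* : ∀ m n {f g} → DegreeBelow m f → DegreeBelow n g →
           DegreeBelow (m ℕ.+ n) (λ y → f y ℤ.* g y)
degree-* zero    n       {f} {g} c d = degree-zero n (λ y → cong (λ k → k ℤ.* g y) (c y))
degree-* (suc m) zero    {f} {g} c d = degree-zero (suc m ℕ.+ 0)
  (λ y → trans (cong (λ k → f y ℤ.* k) (d y)) (ℤₚ.*-zeroʳ (f y)))
degree-* (suc m) (suc n) {f} {g} c d =
  degree-cong (m ℕ.+ suc n)
    (λ y → leibniz (f (y ℤ.+ 1ℤ)) (f y) (g (y ℤ.+ 1ℤ)) (g y))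
    (degree-+ (m ℕ.+ suc n)
      (subst (λ k → DegreeBelow k (λ y → f (y ℤ.+ 1ℤ) ℤ.* δ g y)) (sym (ℕₚ.+-suc m n))
        (degree-* (suc m) n {λ y → f (y ℤ.+ 1ℤ)} {δ g} (degree-shift (suc m) {f} c) d))
      (degree-* m (suc n) {δ f} {g} c d))
  where
  leibniz : ∀ a b c d → a ℤ.* (c ℤ.- d) ℤ.+ (a ℤ.- b) ℤ.* d ≡ a ℤ.* c ℤ.- b ℤ.* d
  leibniz = solve-∀

-- A strict upper bound for the degree in variable 0.
degree : Term → ℕ
degree (var zero)    = 2
degree (var (suc i)) = 1
degree `0            = 1
degree `1            = 1
degree (s `+ t)      = degree s ℕ.⊔ degree t
degree (s `* t)      = degree s ℕ.+ degree t
degree (`- t)        = degree t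

value : Env ℤ-str → Term → ℤ → ℤ
value ρ t y = evalT ℤ-str (y ◂ᶻ ρ) t

degree-correct : ∀ ρ t → DegreeBelow (degree t) (value ρ t)
degree-correct ρ (var zero) y  = second-difference y
  where
  second-difference : ∀ y → (y ℤ.+ 1ℤ ℤ.+ 1ℤ ℤ.- (y ℤ.+ 1ℤ)) ℤ.- (y ℤ.+ 1ℤ ℤ.- y) ≡ 0ℤ
  second-difference = solve-∀
degree-correct ρ (var (suc i)) y = ℤₚ.+-inverseʳ (ρ i)
degree-correct ρ `0 y = refl
degree-correct ρ `1 y = refl
degree-correct ρ (s `+ t) = degree-+ (degree s ℕ.⊔ degree t)
  (degree-mono (ℕₚ.m≤m⊔n (degree s) (degree t)) (degree-correct ρ s))
  (degree-mono (ℕₚ.m≤n⊔m (degree s) (degree t)) (degree-correct ρ t))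
degree-correct ρ (s `* t) = degree-* (degree s) (degree t) (degree-correct ρ s) (degree-correct ρ t)
degree-correct ρ (`- t)   = degree-neg (degree t) (degree-correct ρ t)

value-Δ : ∀ ρ t y → δ (value ρ t) y ≡ value ρ (Δ t) y
value-Δ ρ t y = cong (λ k → k ℤ.- value ρ t y)
  (sym (eval-atT ℤ-str 1 (var 0 `+ `1) (y ◂ᶻ ρ) t))

-- Families of terms closed under differences

Difference-in : Term → List Term → Set
Difference-in t F = Δ t ∈ F ⊎ (∀ ρ y → value ρ (Δ t) y ≡ 0ℤ)

-- The difference of a term comes later in the list, or is identically zero, as for the last term of
-- a tower. Recursion along the list thus takes the place of induction on the degree.
data Closed : List Term → Set where
  []  : Closed []
  _∷_ : ∀ {t F} → Difference-in t F → Closed F → Closed (t ∷ F)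

tower : ℕ → Term → List Term → List Term
tower zero    t F = F
tower (suc n) t F = t ∷ tower n (Δ t) F

tower-closed : ∀ n t {F} → (∀ ρ → DegreeBelow n (value ρ t)) → Closed F → Closed (tower n t F)
tower-closed zero    t       d c = c
tower-closed (suc n) t {F} d c = head n d′ ∷ tower-closed n (Δ t) d′ c
  where
  d′ : ∀ ρ → DegreeBelow n (value ρ (Δ t))
  d′ ρ = degree-cong n (value-Δ ρ t) (d ρ)
  head : ∀ n → (∀ ρ → DegreeBelow n (value ρ (Δ t))) →
         Difference-in t (tower n (Δ t) F)
  head zero    z = inj₂ z
  head (suc n) _ = inj₁ (here refl)

-- `NonNeg` only tells nonnegative from negative values; an equation therefore contributes the
-- difference of its sides in both orders.
atoms : Formula → List Term
atoms (s `≈ t) = (s `+ (`- t)) ∷ (t `+ (`- s)) ∷ []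
atoms (s `≤ t) = (t `+ (`- s)) ∷ []
atoms (`¬ φ)   = atoms φ
atoms (φ `∧ ψ) = atoms φ ++ atoms ψ
atoms (φ `∨ ψ) = atoms φ ++ atoms ψ
atoms (φ `⇒ ψ) = atoms φ ++ atoms ψ
atoms _        = []

-- Each tower starts with `t` and has one term more than `degree t`, so that `t` is in the list
-- without a proof that its degree bound is positive.
towers : List Term → List Term
towers []       = []
towers (t ∷ ts) = t ∷ tower (degree t) (Δ t) (towers ts)

towers-closed : ∀ ts → Closed (towers ts)
towers-closed []       = []
towers-closed (t ∷ ts) = tower-closed (suc (degree t)) t
  (λ ρ → degree-mono (ℕₚ.n≤1+n (degree t)) (degree-correct ρ t)) (towers-closed ts)

tower-⊇ : ∀ {P : Term → Set} n t {F} → All P (tower n t F) → All P F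
tower-⊇ zero    t ps       = ps
tower-⊇ (suc n) t (_ ∷ ps) = tower-⊇ n (Δ t) ps

towers-⊇ : ∀ {P : Term → Set} ts → All P (towers ts) → All P ts
towers-⊇ []       ps       = []
towers-⊇ (t ∷ ts) (p ∷ ps) = p ∷ towers-⊇ ts (tower-⊇ (degree t) (Δ t) ps)

-- Sign conditions on families of terms

NonNeg : ∀ M → Env M → Term → Structure.Carrier M → Set
NonNeg M ρ t y = Sat M (_∷ₑ_ M y ρ) (`0 `≤ t)

SameSign : ∀ M → Env M → (u v : Structure.Carrier M) → Term → Set
SameSign M ρ u v t = NonNeg M ρ t u ⇔ NonNeg M ρ t v

sameSign : ℕ → Term → Term → List Term → Formula
sameSign k a b []      = `⊤
sameSign k a b (t ∷ F) = ((p `⇒ q) `∧ (q `⇒ p)) `∧ sameSign k a b F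
  where
  p = atF k a (`0 `≤ t)
  q = atF k b (`0 `≤ t)

sameSign-open : ∀ k a b F → Open (sameSign k a b F)
sameSign-open k a b []      = tt
sameSign-open k a b (t ∷ F) = ((tt , tt) , (tt , tt)) , sameSign-open k a b F

Sat-sameSign : ∀ M k a b e F → Sat M e (sameSign k a b F) ⇔
               All (SameSign M (drop k e) (evalT M e a) (evalT M e b)) F
Sat-sameSign M k a b e []      = mk⇔ (λ _ → []) (λ _ → tt)
Sat-sameSign M k a b e (t ∷ F) = mk⇔
  (λ ((f , g) , s) → mk⇔ (to q ∘ f ∘ from p) (to p ∘ g ∘ from q) ∷ to ih s)
  (λ { (i ∷ is) → (from q ∘ to i ∘ to p , from p ∘ from i ∘ to q) , from ih is })
  where
  p = Sat-atF M k a e (`0 `≤ t) tt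
  q = Sat-atF M k b e (`0 `≤ t) tt
  ih = Sat-sameSign M k a b e F

-- With Δt of constant sign on [u, ∞), this makes the sign of t constant there, too.
settled : Term → Formula
settled t = ((`1 `≤ Δ t) `⇒ (`1 `≤ t)) `∧ ((Δ t `≤ (`- `1)) `⇒ (t `≤ (`- `1)))

allSettled : List Term → Formula
allSettled []      = `⊤
allSettled (t ∷ F) = settled t `∧ allSettled F

allSettled-open : ∀ F → Open (allSettled F)
allSettled-open []      = tt
allSettled-open (t ∷ F) = ((tt , tt) , (tt , tt)) , allSettled-open F

-- Signs on integer intervals

interval-monotone : ∀ (f : ℤ → ℤ) u v →
  (∀ y → u ℤ.≤ y → y ℤ.+ 1ℤ ℤ.≤ v → f y ℤ.≤ f (y ℤ.+ 1ℤ)) →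
  ∀ y → u ℤ.≤ y → y ℤ.≤ v → f u ℤ.≤ f y
interval-monotone f u v step = ℤ-induction (λ y → y ℤ.≤ v → f u ℤ.≤ f y) u
  (λ _ → ℤₚ.≤-refl)
  (λ y u≤y ih y+1≤v → ℤₚ.≤-trans (ih (ℤₚ.≤-trans (ℤₚ.i≤i+j y 1ℤ) y+1≤v)) (step y u≤y y+1≤v))

monotone : ∀ (f : ℤ → ℤ) u → (∀ y → u ℤ.≤ y → f y ℤ.≤ f (y ℤ.+ 1ℤ)) →
           ∀ y → u ℤ.≤ y → f u ℤ.≤ f y
monotone f u step y u≤y = interval-monotone f u y (λ z u≤z _ → step z u≤z) y u≤y ℤₚ.≤-refl

δ-increasing : ∀ (f : ℤ → ℤ) y → 0ℤ ℤ.≤ δ f y → f y ℤ.≤ f (y ℤ.+ 1ℤ)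
δ-increasing f y = ℤₚ.0≤i-j⇒j≤i

δ-decreasing : ∀ (f : ℤ → ℤ) y → δ f y ℤ.≤ 0ℤ → ℤ.- f y ℤ.≤ ℤ.- f (y ℤ.+ 1ℤ)
δ-decreasing f y = ℤₚ.neg-mono-≤ ∘ ℤₚ.i-j≤0⇒i≤j

-- The constant sign of `δ f` makes `f` monotone, so that `f y` lies between `f u` and `f v`, which
-- have the same sign.
sign-constant : ∀ (f : ℤ → ℤ) u v →
  (∀ y → u ℤ.≤ y → y ℤ.≤ v → 0ℤ ℤ.≤ δ f u ⇔ 0ℤ ℤ.≤ δ f y) →
  0ℤ ℤ.≤ f u ⇔ 0ℤ ℤ.≤ f v →
  ∀ y → u ℤ.≤ y → y ℤ.≤ v → 0ℤ ℤ.≤ f u ⇔ 0ℤ ℤ.≤ f y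
sign-constant f u v δ-same same y u≤y y≤v with 0ℤ ℤ.≤? δ f u
... | yes 0≤δ = mk⇔
  (λ 0≤fu → ℤₚ.≤-trans 0≤fu (interval-monotone f u v up y u≤y y≤v))
  (λ 0≤fy → from same (ℤₚ.≤-trans 0≤fy
    (interval-monotone f y v (λ z y≤z → up z (ℤₚ.≤-trans u≤y y≤z)) v y≤v ℤₚ.≤-refl)))
  where
  up : ∀ z → u ℤ.≤ z → z ℤ.+ 1ℤ ℤ.≤ v → f z ℤ.≤ f (z ℤ.+ 1ℤ)
  up z u≤z z+1≤v =
    δ-increasing f z (to (δ-same z u≤z (ℤₚ.≤-trans (ℤₚ.i≤i+j z 1ℤ) z+1≤v)) 0≤δ)
... | no 0≰δ = mk⇔
  (λ 0≤fu → ℤₚ.≤-trans (to same 0≤fu) (ℤₚ.neg-cancel-≤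
    (interval-monotone (ℤ.-_ ∘ f) y v (λ z y≤z → down z (ℤₚ.≤-trans u≤y y≤z)) v y≤v ℤₚ.≤-refl)))
  (λ 0≤fy → ℤₚ.≤-trans 0≤fy (ℤₚ.neg-cancel-≤
    (interval-monotone (ℤ.-_ ∘ f) u v down y u≤y y≤v)))
  where
  down : ∀ z → u ℤ.≤ z → z ℤ.+ 1ℤ ℤ.≤ v → ℤ.- f z ℤ.≤ ℤ.- f (z ℤ.+ 1ℤ)
  down z u≤z z+1≤v = δ-decreasing f z (ℤₚ.<⇒≤ (ℤₚ.≰⇒>
    (0≰δ ∘ from (δ-same z u≤z (ℤₚ.≤-trans (ℤₚ.i≤i+j z 1ℤ) z+1≤v)))))

-- Zero is separated from positive here, as a null difference means a constant and a positive one
-- unbounded growth. Over ℤ, strict signs are bounds by 1 and -1.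
data SignBeyond (f : ℤ → ℤ) (u : ℤ) : Set where
  positive : (∀ y → u ℤ.≤ y → 1ℤ ℤ.≤ f y)  → SignBeyond f u
  null     : (∀ y → u ℤ.≤ y → f y ≡ 0ℤ)    → SignBeyond f u
  negative : (∀ y → u ℤ.≤ y → f y ℤ.≤ -1ℤ) → SignBeyond f u

signBeyond-cong : ∀ {f g u} → (∀ y → f y ≡ g y) → SignBeyond f u → SignBeyond g u
signBeyond-cong h (positive s) = positive (λ y u≤y → subst (1ℤ ℤ.≤_) (h y) (s y u≤y))
signBeyond-cong h (null s)     = null (λ y u≤y → trans (sym (h y)) (s y u≤y))
signBeyond-cong h (negative s) = negative (λ y u≤y → subst (ℤ._≤ -1ℤ) (h y) (s y u≤y))

1≰-1 : ¬ (1ℤ ℤ.≤ -1ℤ)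
1≰-1 ()

1≰0 : ¬ (1ℤ ℤ.≤ 0ℤ)
1≰0 (ℤ.+≤+ ())

0≰-1 : ¬ (0ℤ ℤ.≤ -1ℤ)
0≰-1 ()

-- If the difference is positive, `f` increases from a value that is at least 1 by the first
-- implication; the negative case is symmetric. If the difference is null, `f` is constant and keeps
-- whatever sign it has at `u`.
sign-settles : ∀ (f : ℤ → ℤ) u → SignBeyond (δ f) u →
               (1ℤ ℤ.≤ δ f u → 1ℤ ℤ.≤ f u) → (δ f u ℤ.≤ -1ℤ → f u ℤ.≤ -1ℤ) → SignBeyond f u
sign-settles f u (positive s) up down = positive λ y u≤y →
  ℤₚ.≤-trans (up (s u ℤₚ.≤-refl))
    (monotone f u (λ z u≤z → δ-increasing f z (ℤₚ.≤-trans (ℤ.+≤+ z≤n) (s z u≤z))) y u≤y)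
sign-settles f u (negative s) up down = negative λ y u≤y →
  ℤₚ.≤-trans (ℤₚ.neg-cancel-≤
    (monotone (ℤ.-_ ∘ f) u (λ z u≤z → δ-decreasing f z (ℤₚ.≤-trans (s z u≤z) ℤ.-≤+)) y u≤y))
    (down (s u ℤₚ.≤-refl))
sign-settles f u (null s) up down = by-sign (ℤₚ.<-cmp (f u) 0ℤ)
  where
  constant : ∀ y → u ℤ.≤ y → f u ≡ f y
  constant y u≤y = ℤₚ.≤-antisym
    (monotone f u (λ z u≤z → δ-increasing f z (ℤₚ.≤-reflexive (sym (s z u≤z)))) y u≤y)
    (ℤₚ.neg-cancel-≤
      (monotone (ℤ.-_ ∘ f) u (λ z u≤z → δ-decreasing f z (ℤₚ.≤-reflexive (s z u≤z))) y u≤y))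
  by-sign : Tri (f u ℤ.< 0ℤ) (f u ≡ 0ℤ) (f u ℤ.> 0ℤ) → SignBeyond f u
  by-sign (tri< f<0 _ _) = negative λ y u≤y →
    subst (ℤ._≤ -1ℤ) (constant y u≤y) (ℤₚ.i<j⇒i≤pred[j] f<0)
  by-sign (tri≈ _ f≡0 _) = null λ y u≤y → trans (sym (constant y u≤y)) f≡0
  by-sign (tri> _ _ f>0) = positive λ y u≤y →
    subst (1ℤ ℤ.≤_) (constant y u≤y) (ℤₚ.i<j⇒suc[i]≤j f>0)

i≤i² : ∀ i → i ℤ.≤ i ℤ.* i
i≤i² (+ zero)     = ℤ.+≤+ z≤n
i≤i² (+ suc n)    = ℤ.+≤+ (ℕₚ.m≤m+n (suc n) (n ℕ.* suc n))
i≤i² (ℤ.-[1+ n ]) = ℤ.-≤+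

0≤i² : ∀ i → 0ℤ ℤ.≤ i ℤ.* i
0≤i² (+ zero)     = ℤ.+≤+ z≤n
0≤i² (+ suc n)    = ℤ.+≤+ z≤n
0≤i² (ℤ.-[1+ n ]) = ℤ.+≤+ z≤n

square-neg : ∀ i → ℤ.- i ℤ.* ℤ.- i ≡ i ℤ.* i
square-neg = solve-∀

-- A function of slope at least 1 beyond u is positive after 1 + f(u)² ≥ 1 − f(u) steps.
leap : (ℤ → ℤ) → ℤ → ℤ
leap f u = u ℤ.+ (1ℤ ℤ.+ f u ℤ.* f u)

≤-leap : ∀ f u → u ℤ.≤ leap f u
≤-leap f u = ℤₚ.≤-trans (ℤₚ.≤-reflexive (sym (ℤₚ.+-identityʳ u)))
  (ℤₚ.+-monoʳ-≤ u (ℤₚ.+-mono-≤ (ℤ.+≤+ z≤n) (0≤i² (f u))))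

-- The function f(y) - y does not decrease beyond `u`, so f gains at least 1 + f(u)² over the leap,
-- and -f(u) ≤ f(u)².
leap-positive : ∀ f u → (∀ y → u ℤ.≤ y → 1ℤ ℤ.≤ δ f y) → 1ℤ ℤ.≤ f (leap f u)
leap-positive f u s = ℤₚ.0≤i-j⇒j≤i (subst (0ℤ ℤ.≤_) (regroup (f (leap f u)) (f u) u)
  (ℤₚ.+-mono-≤ (ℤₚ.i≤j⇒0≤j-i slope) (ℤₚ.i≤j⇒0≤j-i -fu≤fu²)))
  where
  -fu≤fu² : ℤ.- f u ℤ.≤ f u ℤ.* f u
  -fu≤fu² = subst (ℤ.- f u ℤ.≤_) (square-neg (f u)) (i≤i² (ℤ.- f u))
  tilt : ∀ a b y → a ℤ.- b ℤ.- 1ℤ ≡ a ℤ.- (y ℤ.+ 1ℤ) ℤ.- (b ℤ.- y)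
  tilt = solve-∀
  slope : f u ℤ.- u ℤ.≤ f (leap f u) ℤ.- leap f u
  slope = monotone (λ y → f y ℤ.- y) u (λ y u≤y → ℤₚ.0≤i-j⇒j≤i
    (subst (0ℤ ℤ.≤_) (tilt (f (y ℤ.+ 1ℤ)) (f y) y) (ℤₚ.i≤j⇒0≤j-i (s y u≤y))))
    (leap f u) (≤-leap f u)
  regroup : ∀ a b u → (a ℤ.- (u ℤ.+ (1ℤ ℤ.+ b ℤ.* b)) ℤ.- (b ℤ.- u)) ℤ.+ (b ℤ.* b ℤ.- ℤ.- b)
                      ≡ a ℤ.- 1ℤ
  regroup = solve-∀

leap-negative : ∀ f u → (∀ y → u ℤ.≤ y → δ f y ℤ.≤ -1ℤ) → f (leap f u) ℤ.≤ -1ℤ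
leap-negative f u s = ℤₚ.neg-cancel-≤ (subst (λ i → 1ℤ ℤ.≤ ℤ.- f (u ℤ.+ (1ℤ ℤ.+ i)))
  (square-neg (f u)) (leap-positive (ℤ.-_ ∘ f) u λ y u≤y →
    subst (1ℤ ℤ.≤_) (ℤₚ.neg-distrib-+ (f (y ℤ.+ 1ℤ)) (ℤ.- f y)) (ℤₚ.neg-mono-≤ (s y u≤y))))

-- The leap serves the implication whose premise matches the sign of `δ f`; a premise that does not
-- match is contradictory.
leap-settles : ∀ f u → SignBeyond (δ f) u → let v = leap f u in
               (1ℤ ℤ.≤ δ f v → 1ℤ ℤ.≤ f v) × (δ f v ℤ.≤ -1ℤ → f v ℤ.≤ -1ℤ)
leap-settles f u s = up s , down s
  where
  v = leap f u
  u≤v = ≤-leap f u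
  up : SignBeyond (δ f) u → 1ℤ ℤ.≤ δ f v → 1ℤ ℤ.≤ f v
  up (positive s) _   = leap-positive f u s
  up (null s)     1≤δ = ⊥-elim (1≰0 (subst (1ℤ ℤ.≤_) (s v u≤v) 1≤δ))
  up (negative s) 1≤δ = ⊥-elim (1≰-1 (ℤₚ.≤-trans 1≤δ (s v u≤v)))
  down : SignBeyond (δ f) u → δ f v ℤ.≤ -1ℤ → f v ℤ.≤ -1ℤ
  down (positive s) δ≤-1 = ⊥-elim (1≰-1 (ℤₚ.≤-trans (s v u≤v) δ≤-1))
  down (null s)     δ≤-1 = ⊥-elim (0≰-1 (subst (ℤ._≤ -1ℤ) (s v u≤v) δ≤-1))
  down (negative s) _    = leap-negative f u s

1≤-beyond : ∀ {f u v} → SignBeyond f u → u ℤ.≤ v → 1ℤ ℤ.≤ f u ⇔ 1ℤ ℤ.≤ f v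
1≤-beyond {u = u} {v} (positive s) u≤v = mk⇔ (const (s v u≤v)) (const (s u ℤₚ.≤-refl))
1≤-beyond {u = u} {v} (null s)     u≤v = ≡⇒⇔ (cong (1ℤ ℤ.≤_) (trans (s u ℤₚ.≤-refl) (sym (s v u≤v))))
1≤-beyond {u = u} {v} (negative s) u≤v =
  mk⇔ (λ 1≤f → ⊥-elim (1≰-1 (ℤₚ.≤-trans 1≤f (s u ℤₚ.≤-refl))))
      (λ 1≤f → ⊥-elim (1≰-1 (ℤₚ.≤-trans 1≤f (s v u≤v))))

≤-1-beyond : ∀ {f u v} → SignBeyond f u → u ℤ.≤ v → f u ℤ.≤ -1ℤ ⇔ f v ℤ.≤ -1ℤ
≤-1-beyond {u = u} {v} (positive s) u≤v =
  mk⇔ (λ f≤-1 → ⊥-elim (1≰-1 (ℤₚ.≤-trans (s u ℤₚ.≤-refl) f≤-1)))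
      (λ f≤-1 → ⊥-elim (1≰-1 (ℤₚ.≤-trans (s v u≤v) f≤-1)))
≤-1-beyond {u = u} {v} (null s)     u≤v = ≡⇒⇔ (cong (ℤ._≤ -1ℤ) (trans (s u ℤₚ.≤-refl) (sym (s v u≤v))))
≤-1-beyond {u = u} {v} (negative s) u≤v = mk⇔ (const (s v u≤v)) (const (s u ℤₚ.≤-refl))

0≤⇔≰-1 : ∀ i → 0ℤ ℤ.≤ i ⇔ (¬ (i ℤ.≤ -1ℤ))
0≤⇔≰-1 i = mk⇔ (λ 0≤i i≤-1 → 0≰-1 (ℤₚ.≤-trans 0≤i i≤-1))
                (λ i≰-1 → ℤₚ.i<j⇒suc[i]≤j (ℤₚ.≰⇒> i≰-1))

0≤-beyond : ∀ {f u v} → SignBeyond f u → u ℤ.≤ v → 0ℤ ℤ.≤ f u ⇔ 0ℤ ℤ.≤ f v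
0≤-beyond s u≤v = mk⇔
  (from (0≤⇔≰-1 _) ∘ to ¬neg ∘ to (0≤⇔≰-1 _))
  (from (0≤⇔≰-1 _) ∘ from ¬neg ∘ to (0≤⇔≰-1 _))
  where ¬neg = ¬-⇔ (≤-1-beyond s u≤v)

-- A condition on the two end points controls the whole interval: by recursion along the list `Δ t`
-- has constant sign there, or it is identically zero, and `sign-constant` passes this on to `t`.
sameSign-between : ∀ {F} → Closed F → ∀ {ρ u v} → All (SameSign ℤ-str ρ u v) F →
                   ∀ y → u ℤ.≤ y → y ℤ.≤ v → All (SameSign ℤ-str ρ u y) F
sameSign-between [] [] y u≤y y≤v = []
sameSign-between {t ∷ F} (d ∷ c) {ρ} {u} {v} (s ∷ ss) y u≤y y≤v =
  sign-constant (value ρ t) u v (δ-same d) s y u≤y y≤v ∷ ih y u≤y y≤v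
  where
  ih = sameSign-between c ss
  δ-same : Difference-in t F → ∀ y → u ℤ.≤ y → y ℤ.≤ v →
           0ℤ ℤ.≤ δ (value ρ t) u ⇔ 0ℤ ℤ.≤ δ (value ρ t) y
  δ-same d y u≤y y≤v = subst₂ (λ i j → 0ℤ ℤ.≤ i ⇔ 0ℤ ℤ.≤ j)
    (sym (value-Δ ρ t u)) (sym (value-Δ ρ t y)) (Δ-same d)
    where
    Δ-same : Difference-in t F → 0ℤ ℤ.≤ value ρ (Δ t) u ⇔ 0ℤ ℤ.≤ value ρ (Δ t) y
    Δ-same (inj₁ i) = All.lookup (ih y u≤y y≤v) i
    Δ-same (inj₂ z) = ≡⇒⇔ (cong (0ℤ ℤ.≤_) (trans (z ρ u) (sym (z ρ y))))

sameSign-restrict : ∀ {F} → Closed F → ∀ {ρ u v} → All (SameSign ℤ-str ρ u v) F →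
                    ∀ {u′ v′} → u ℤ.≤ u′ → u′ ℤ.≤ v′ → v′ ℤ.≤ v →
                    All (SameSign ℤ-str ρ u′ v′) F
sameSign-restrict c ss u≤u′ u′≤v′ v′≤v = All.zipWith
  (λ (p , q) → mk⇔ (to q ∘ from p) (to p ∘ from q))
  (sameSign-between c ss _ u≤u′ (ℤₚ.≤-trans u′≤v′ v′≤v) ,
   sameSign-between c ss _ (ℤₚ.≤-trans u≤u′ u′≤v′) v′≤v)

Sat-settled : ∀ ρ t u → let f = value ρ t in Sat ℤ-str (u ◂ᶻ ρ) (settled t) ⇔
              ((1ℤ ℤ.≤ δ f u → 1ℤ ℤ.≤ f u) × (δ f u ℤ.≤ -1ℤ → f u ℤ.≤ -1ℤ))
Sat-settled ρ t u = ≡⇒⇔ (cong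
  (λ i → (1ℤ ℤ.≤ i → 1ℤ ℤ.≤ value ρ t u) × (i ℤ.≤ -1ℤ → value ρ t u ℤ.≤ -1ℤ))
  (sym (value-Δ ρ t u)))

δ-signBeyond : ∀ {t F ρ u} → Difference-in t F → All (λ s → SignBeyond (value ρ s) u) F →
               SignBeyond (δ (value ρ t)) u
δ-signBeyond {t} {ρ = ρ} (inj₁ i) ss = signBeyond-cong (λ y → sym (value-Δ ρ t y)) (All.lookup ss i)
δ-signBeyond {t} {ρ = ρ} (inj₂ z) ss = null (λ y _ → trans (value-Δ ρ t y) (z ρ y))

settled-signBeyond : ∀ {F} → Closed F → ∀ {ρ u} → Sat ℤ-str (u ◂ᶻ ρ) (allSettled F) →
                     All (λ t → SignBeyond (value ρ t) u) F
settled-signBeyond [] _ = []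
settled-signBeyond {t ∷ F} (d ∷ c) {ρ} {u} (s , ss) = head ∷ ih
  where
  ih = settled-signBeyond c ss
  head = let up , down = to (Sat-settled ρ t u) s in
         sign-settles (value ρ t) u (δ-signBeyond d ih) up down

-- The signs of `t` and of its difference do not change beyond `u`, so the implications at `v`
-- follow from those at `u`.
settled-beyond : ∀ {F} → Closed F → ∀ {ρ u v} → u ℤ.≤ v →
                 Sat ℤ-str (u ◂ᶻ ρ) (allSettled F) → Sat ℤ-str (v ◂ᶻ ρ) (allSettled F)
settled-beyond [] _ _ = tt
settled-beyond {t ∷ F} (d ∷ c) {ρ} {u} {v} u≤v (s , ss) =
  from (Sat-settled ρ t v)
    ( to (1≤-beyond f-sign u≤v) ∘ up ∘ from (1≤-beyond δ-sign u≤v)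
    , to (≤-1-beyond f-sign u≤v) ∘ down ∘ from (≤-1-beyond δ-sign u≤v))
  , settled-beyond c u≤v ss
  where
  up     = proj₁ (to (Sat-settled ρ t u) s)
  down   = proj₂ (to (Sat-settled ρ t u) s)
  δ-sign = δ-signBeyond d (settled-signBeyond c ss)
  f-sign = sign-settles (value ρ t) u δ-sign up down

-- Once the terms after `t` are settled, the leap settles `t`, and the others stay settled over it.
settled-leap : ∀ {t F} → Closed (t ∷ F) → ∀ {ρ u} → Sat ℤ-str (u ◂ᶻ ρ) (allSettled F) →
               Sat ℤ-str (leap (value ρ t) u ◂ᶻ ρ) (allSettled (t ∷ F))
settled-leap {t} (d ∷ c) {ρ} {u} ss =
  from (Sat-settled ρ t (leap (value ρ t) u))
    (leap-settles (value ρ t) u (δ-signBeyond d (settled-signBeyond c ss)))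
  , settled-beyond c (≤-leap (value ρ t) u) ss

atoms-decide : ∀ φ → Open φ → ∀ {ρ u v} → All (SameSign ℤ-str ρ u v) (atoms φ) →
               Sat ℤ-str (u ◂ᶻ ρ) φ ⇔ Sat ℤ-str (v ◂ᶻ ρ) φ
atoms-decide `⊤ o ss = ⇔-id _
atoms-decide `⊥ o ss = ⇔-id _
atoms-decide (s `≈ t) o (p ∷ q ∷ []) = mk⇔
  (λ s≡t → antisym (to p (ℤₚ.i≤j⇒0≤j-i (ℤₚ.≤-reflexive (sym s≡t))))
                   (to q (ℤₚ.i≤j⇒0≤j-i (ℤₚ.≤-reflexive s≡t))))
  (λ s≡t → antisym (from p (ℤₚ.i≤j⇒0≤j-i (ℤₚ.≤-reflexive (sym s≡t))))
                   (from q (ℤₚ.i≤j⇒0≤j-i (ℤₚ.≤-reflexive s≡t))))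
  where
  antisym : ∀ {i j} → 0ℤ ℤ.≤ i ℤ.- j → 0ℤ ℤ.≤ j ℤ.- i → i ≡ j
  antisym 0≤i-j 0≤j-i = ℤₚ.≤-antisym (ℤₚ.0≤i-j⇒j≤i 0≤j-i) (ℤₚ.0≤i-j⇒j≤i 0≤i-j)
atoms-decide (s `≤ t) o (p ∷ []) = mk⇔
  (ℤₚ.0≤i-j⇒j≤i ∘ to p ∘ ℤₚ.i≤j⇒0≤j-i) (ℤₚ.0≤i-j⇒j≤i ∘ from p ∘ ℤₚ.i≤j⇒0≤j-i)
atoms-decide (`¬ φ) o ss = ¬-⇔ (atoms-decide φ o ss)
atoms-decide (φ `∧ ψ) (o₁ , o₂) ss =
  atoms-decide φ o₁ (Allₚ.++⁻ˡ (atoms φ) ss) ×-⇔ atoms-decide ψ o₂ (Allₚ.++⁻ʳ (atoms φ) ss)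
atoms-decide (φ `∨ ψ) (o₁ , o₂) ss =
  atoms-decide φ o₁ (Allₚ.++⁻ˡ (atoms φ) ss) ⊎-⇔ atoms-decide ψ o₂ (Allₚ.++⁻ʳ (atoms φ) ss)
atoms-decide (φ `⇒ ψ) (o₁ , o₂) ss =
  →-⇔ (atoms-decide φ o₁ (Allₚ.++⁻ˡ (atoms φ) ss)) (atoms-decide ψ o₂ (Allₚ.++⁻ʳ (atoms φ) ss))

-- Certificates

-- The variables from index i on are the last points of j successive intervals, the first of
-- which starts at a. On each of them, and beyond the last one, F has constant signs and φ fails.
certificate : List Term → Formula → ℕ → (j i : ℕ) → Term → Formula
certificate F φ k zero    i a = atF k a (allSettled F) `∧ (`¬ atF k a φ)
certificate F φ k (suc j) i a =
  sameSign k a (var i) F `∧ ((`¬ atF k a φ) `∧ certificate F φ k j (suc i) (var i `+ `1))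

certificate-open : ∀ F φ k j i a → Open φ → Open (certificate F φ k j i a)
certificate-open F φ k zero    i a o =
  substF-open _ (allSettled F) (allSettled-open F) , substF-open _ φ o
certificate-open F φ k (suc j) i a o =
  sameSign-open k a (var i) F , substF-open _ φ o , certificate-open F φ k j (suc i) _ o

-- A point from `a` on lies in the first interval, where φ has the truth value that it has at `a`,
-- or beyond its end, which leaves a shorter certificate. On the final half-line φ again behaves as
-- at its first point.
certificate-sound : ∀ φ → Open φ → ∀ k j i a e →
  Sat ℤ-str e (certificate (towers (atoms φ)) φ k j i a) →
  ∀ y → evalT ℤ-str e a ℤ.≤ y → ¬ Sat ℤ-str (y ◂ᶻ drop k e) φ
certificate-sound φ o k zero i a e (s , ¬φa) y a≤y =
  ¬φa ∘ from (Sat-atF ℤ-str k a e φ o) ∘ from (atoms-decide φ o same)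
  where
  F = towers (atoms φ)
  same = towers-⊇ (atoms φ) (All.map (λ s → 0≤-beyond s a≤y)
    (settled-signBeyond (towers-closed (atoms φ))
      (to (Sat-atF ℤ-str k a e (allSettled F) (allSettled-open F)) s)))
certificate-sound φ o k (suc j) i a e (s , ¬φa , rest) y a≤y with y ℤ.≤? e i
... | no y≰w  = certificate-sound φ o k j (suc i) (var i `+ `1) e rest y
  (subst (ℤ._≤ y) (ℤₚ.+-comm 1ℤ (e i)) (ℤₚ.i<j⇒suc[i]≤j (ℤₚ.≰⇒> y≰w)))
... | yes y≤w = ¬φa ∘ from (Sat-atF ℤ-str k a e φ o) ∘ from (atoms-decide φ o same)
  where
  same = towers-⊇ (atoms φ) (sameSign-between (towers-closed (atoms φ))
    (to (Sat-sameSign ℤ-str k a (var i) e (towers (atoms φ))) s) y a≤y y≤w)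

prepend : ∀ {A : Set} → List A → (ℕ → A) → ℕ → A
prepend []       ρ i       = ρ i
prepend (w ∷ ws) ρ zero    = w
prepend (w ∷ ws) ρ (suc i) = prepend ws ρ i

drop-prepend : ∀ {A : Set} (ws : List A) ρ → drop (length ws) (prepend ws ρ) ≡ ρ
drop-prepend []       ρ = refl
drop-prepend (w ∷ ws) ρ = drop-prepend ws ρ

-- Intervals in a model of DOI

module _ (em : ExcludedMiddle 0ℓ) (M : Structure) (doi : IsDOI M) where
  open Structure M

  private
    infixr 5 _◂_
    _◂_ : Carrier → Env M → Env M
    _◂_ = _∷ₑ_ M

    ordered : IsDiscretelyOrderedRing M
    ordered = proj₁ (proj₁ doi)

    inherits : Inherits∀ M
    inherits = diophantineCorrect⇒inherits∀ M (proj₂ doi)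

    ≤-refl : ∀ {a} → a ≤ᴹ a
    ≤-refl = IsDiscretelyOrderedRing.≤-refl ordered _

    ≤-trans : ∀ {a b c} → a ≤ᴹ b → b ≤ᴹ c → a ≤ᴹ c
    ≤-trans = IsDiscretelyOrderedRing.≤-trans ordered _ _ _

    +-identity : ∀ a → a +ᴹ 0ᴹ ≡ a
    +-identity = IsDiscretelyOrderedRing.+-identity ordered

    +-assoc : ∀ a b c → (a +ᴹ b) +ᴹ c ≡ a +ᴹ (b +ᴹ c)
    +-assoc = IsDiscretelyOrderedRing.+-assoc ordered

    a≤a+b : ∀ {a b} → 0ᴹ ≤ᴹ b → a ≤ᴹ (a +ᴹ b)
    a≤a+b {a} {b} = inherits ((`0 `≤ var 1) `⇒ (var 0 `≤ (var 0 `+ var 1))) _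
      (λ ρ 0≤b → subst (ℤ._≤ ρ 0 ℤ.+ ρ 1) (ℤₚ.+-identityʳ (ρ 0)) (ℤₚ.+-monoʳ-≤ (ρ 0) 0≤b))
      (a ◂ b ◂ λ _ → a)

    0≤1 : 0ᴹ ≤ᴹ 1ᴹ
    0≤1 = inherits (`0 `≤ `1) tt (λ _ → ℤ.+≤+ z≤n) (λ _ → 0ᴹ)

    0≤b-a : ∀ {a b} → a ≤ᴹ b → 0ᴹ ≤ᴹ (b +ᴹ (-ᴹ a))
    0≤b-a {a} {b} = inherits ((var 0 `≤ var 1) `⇒ (`0 `≤ (var 1 `+ (`- var 0)))) _
      (λ ρ → ℤₚ.i≤j⇒0≤j-i) (a ◂ b ◂ λ _ → a)

    a+[b-a] : ∀ a b → a +ᴹ (b +ᴹ (-ᴹ a)) ≡ b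
    a+[b-a] a b = inherits ((var 0 `+ (var 1 `+ (`- var 0))) `≈ var 1) tt
      (λ ρ → identity (ρ 0) (ρ 1)) (a ◂ b ◂ λ _ → a)
      where
      identity : ∀ i j → i ℤ.+ (j ℤ.- i) ≡ j
      identity = solve-∀

  -- If there is no such w, open induction on n proves u + n ≤ v → φ(u + n), and n = v - u
  -- contradicts ¬φ(v).
  last-true : ∀ φ → Open φ → ∀ ρ {u v} → u ≤ᴹ v → Sat M (u ◂ ρ) φ → ¬ Sat M (v ◂ ρ) φ →
              ∃ λ w → u ≤ᴹ w × (w +ᴹ 1ᴹ) ≤ᴹ v × Sat M (w ◂ ρ) φ × ¬ Sat M ((w +ᴹ 1ᴹ) ◂ ρ) φ
  last-true φ o ρ {u} {v} u≤v φu ¬φv = decidable-stable em λ none →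
    ¬φv (subst P (a+[b-a] u v) (to (Sat-θ (v +ᴹ (-ᴹ u)))
      (proj₂ (proj₁ doi) θ (tt , substF-open _ φ o) (u ◂ v ◂ ρ)
        (from (Sat-θ 0ᴹ) (λ _ → subst P (sym (+-identity u)) φu))
        (λ n 0≤n θn → from (Sat-θ (n +ᴹ 1ᴹ)) (step none n 0≤n (to (Sat-θ n) θn)))
        (v +ᴹ (-ᴹ u)) (0≤b-a u≤v))
      (subst (_≤ᴹ v) (sym (a+[b-a] u v)) ≤-refl)))
    where
    P : Carrier → Set
    P y = Sat M (y ◂ ρ) φ

    θ : Formula
    θ = ((var 1 `+ var 0) `≤ var 2) `⇒ atF 3 (var 1 `+ var 0) φ

    Sat-θ : ∀ n → Sat M (n ◂ u ◂ v ◂ ρ) θ ⇔ ((u +ᴹ n) ≤ᴹ v → P (u +ᴹ n))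
    Sat-θ n = →-⇔ (⇔-id _) (Sat-atF M 3 (var 1 `+ var 0) (n ◂ u ◂ v ◂ ρ) φ o)

    step : ¬ (∃ λ w → u ≤ᴹ w × (w +ᴹ 1ᴹ) ≤ᴹ v × P w × ¬ P (w +ᴹ 1ᴹ)) → ∀ n → 0ᴹ ≤ᴹ n →
           ((u +ᴹ n) ≤ᴹ v → P (u +ᴹ n)) → (u +ᴹ (n +ᴹ 1ᴹ)) ≤ᴹ v → P (u +ᴹ (n +ᴹ 1ᴹ))
    step none n 0≤n ih u+n+1≤v = subst P (+-assoc u n 1ᴹ) (decidable-stable em λ ¬φ →
      none (u +ᴹ n , a≤a+b 0≤n , w+1≤v , ih (≤-trans (a≤a+b 0≤1) w+1≤v) , ¬φ))
      where
      w+1≤v : ((u +ᴹ n) +ᴹ 1ᴹ) ≤ᴹ v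
      w+1≤v = subst (_≤ᴹ v) (sym (+-assoc u n 1ᴹ)) u+n+1≤v

  -- The pieces are finite in number in the standard sense, however long they are in `M`, so that a
  -- single formula can speak of all their ends.
  data Partition (R : Carrier → Carrier → Set) (u v : Carrier) : Set where
    whole : u ≤ᴹ v → R u v → Partition R u v
    cut   : ∀ w → u ≤ᴹ w → R u w → Partition R (w +ᴹ 1ᴹ) v → Partition R u v

  _++ᴾ_ : ∀ {R u w v} → Partition R u w → Partition R (w +ᴹ 1ᴹ) v → Partition R u v
  whole u≤w r   ++ᴾ q = cut _ u≤w r q
  cut w u≤w r p ++ᴾ q = cut w u≤w r (p ++ᴾ q)

  refine : ∀ {R S u v} → (∀ {u v} → u ≤ᴹ v → R u v → Partition S u v) →
           Partition R u v → Partition S u v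
  refine f (whole u≤v r)   = f u≤v r
  refine f (cut w u≤w r p) = f u≤w r ++ᴾ refine f p

  module _ (ρ : Env M) where

    Same : List Term → Carrier → Carrier → Set
    Same F u v = All (SameSign M ρ u v) F

    -- For a fixed family this is a universal statement on the four points and the parameters, so it
    -- is inherited from ℤ, where `sameSign-restrict` proves it.
    same-restrict : ∀ {F} → Closed F → ∀ {u u′ v′ v} → u ≤ᴹ u′ → u′ ≤ᴹ v′ → v′ ≤ᴹ v →
                    Same F u v → Same F u′ v′
    same-restrict {F} c {u} {u′} {v′} {v} u≤u′ u′≤v′ v′≤v s =
      to (Sat-sameSign M 4 (var 1) (var 2) e F)
        (inherits χ ((tt , tt , tt , sameSign-open 4 (var 0) (var 3) F) ,
                     sameSign-open 4 (var 1) (var 2) F) χ-true e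
          (u≤u′ , u′≤v′ , v′≤v , from (Sat-sameSign M 4 (var 0) (var 3) e F) s))
      where
      e = u ◂ u′ ◂ v′ ◂ v ◂ ρ
      χ : Formula
      χ = ((var 0 `≤ var 1) `∧ ((var 1 `≤ var 2) `∧ ((var 2 `≤ var 3) `∧
            sameSign 4 (var 0) (var 3) F))) `⇒ sameSign 4 (var 1) (var 2) F
      χ-true : ℤ-str ⊨ χ
      χ-true e (p , q , r , s) = from (Sat-sameSign ℤ-str 4 (var 1) (var 2) e F)
        (sameSign-restrict c (to (Sat-sameSign ℤ-str 4 (var 0) (var 3) e F) s) p q r)

    -- Terms are added from the end of the list. As `Same` compares end points only, a piece [u, v]
    -- whose ends give `t` different signs needs a single cut, at a w with the sign of u such that w
    -- + 1 has that of v.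
    partition : ∀ {F} → Closed F → ∀ {u v} → u ≤ᴹ v → Partition (Same F) u v
    partition []                  u≤v = whole u≤v []
    partition (_∷_ {t} {F} _ c)   u≤v = refine split (partition c u≤v)
      where
      split : ∀ {u v} → u ≤ᴹ v → Same F u v → Partition (Same (t ∷ F)) u v
      split {u} {v} u≤v s with em {NonNeg M ρ t u} | em {NonNeg M ρ t v}
      ... | yes p | yes q = whole u≤v (mk⇔ (const q) (const p) ∷ s)
      ... | no ¬p | no ¬q = whole u≤v (mk⇔ (⊥-elim ∘ ¬p) (⊥-elim ∘ ¬q) ∷ s)
      ... | yes p | no ¬q =
        let w , u≤w , w+1≤v , pw , ¬pw+1 = last-true (`0 `≤ t) tt ρ u≤v p ¬q in
        cut w u≤w (mk⇔ (const pw) (const p) ∷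
                   same-restrict c ≤-refl u≤w (≤-trans (a≤a+b 0≤1) w+1≤v) s)
          (whole w+1≤v (mk⇔ (⊥-elim ∘ ¬pw+1) (⊥-elim ∘ ¬q) ∷
                        same-restrict c (≤-trans u≤w (a≤a+b 0≤1)) w+1≤v ≤-refl s))
      ... | no ¬p | yes q =
        let w , u≤w , w+1≤v , ¬pw , ¬¬pw+1 =
              last-true (`¬ (`0 `≤ t)) tt ρ u≤v ¬p (λ ¬q → ¬q q)
            pw+1 = decidable-stable em ¬¬pw+1
        in
        cut w u≤w (mk⇔ (⊥-elim ∘ ¬p) (⊥-elim ∘ ¬pw) ∷
                   same-restrict c ≤-refl u≤w (≤-trans (a≤a+b 0≤1) w+1≤v) s)
          (whole w+1≤v (mk⇔ (const q) (const pw+1) ∷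
                        same-restrict c (≤-trans u≤w (a≤a+b 0≤1)) w+1≤v ≤-refl s))

    Settled : List Term → Carrier → Set
    Settled F u = Sat M (u ◂ ρ) (allSettled F)

    -- The half-line of a certificate starts one after the end of the last interval.
    settled-suc : ∀ {F} → Closed F → ∀ {u} → Settled F u → Settled F (u +ᴹ 1ᴹ)
    settled-suc {F} c {u} s = to (Sat-atF M 1 u+1 (u ◂ ρ) (allSettled F) o)
      (inherits χ (o , substF-open _ (allSettled F) o) χ-true (u ◂ ρ) s)
      where
      o = allSettled-open F
      u+1 : Term
      u+1 = var 0 `+ `1
      χ : Formula
      χ = allSettled F `⇒ atF 1 u+1 (allSettled F)
      χ-true : ℤ-str ⊨ χ
      χ-true = ∀-strip ℤ-str χ λ ρ y →
        from (Sat-atF ℤ-str 1 u+1 (y ◂ᶻ ρ) (allSettled F) o) ∘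
        settled-beyond c (ℤₚ.i≤i+j y 1ℤ)

    settled-exists : ∀ {F} → Closed F → ∃ λ u → 0ᴹ ≤ᴹ u × Settled F u
    settled-exists []                        = 0ᴹ , ≤-refl , tt
    settled-exists (_∷_ {t} {F} d c) = let u , 0≤u , s = settled-exists c in
      let u≤v , s′ = inherits χ (o , tt , substF-open _ (allSettled (t ∷ F)) o′) χ-true (u ◂ ρ) s in
      evalT M (u ◂ ρ) v , ≤-trans 0≤u u≤v , to (Sat-atF M 1 v (u ◂ ρ) (allSettled (t ∷ F)) o′) s′
      where
      o  = allSettled-open F
      o′ = allSettled-open (t ∷ F)
      v : Term
      -- This is `leap` as a term. The square in place of an absolute value keeps it in the
      -- language, so that the next settled point is named in a universal statement.
      v = var 0 `+ (`1 `+ (t `* t))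
      χ : Formula
      χ = allSettled F `⇒ ((var 0 `≤ v) `∧ atF 1 v (allSettled (t ∷ F)))
      χ-true : ℤ-str ⊨ χ
      χ-true = ∀-strip ℤ-str χ λ ρ y s → ≤-leap (value ρ t) y ,
        from (Sat-atF ℤ-str 1 v (y ◂ᶻ ρ) (allSettled (t ∷ F)) o′) (settled-leap (d ∷ c) s)

    -- The part of `certificate` that concerns signs, with the end points in a list instead of
    -- variables.
    IsCertificate : List Term → Carrier → List Carrier → Set
    IsCertificate F u []       = Settled F u
    IsCertificate F u (w ∷ ws) = Same F u w × IsCertificate F (w +ᴹ 1ᴹ) ws

    partition⇒certificate : ∀ {F u v} → Partition (Same F) u v → Settled F (v +ᴹ 1ᴹ) →
                            ∃ (IsCertificate F u)
    partition⇒certificate {v = v} (whole _ s) settled = v ∷ [] , s , settled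
    partition⇒certificate (cut w _ s p) settled =
      let ws , ss = partition⇒certificate p settled in w ∷ ws , s , ss

    certificate-exists : ∀ {F} → Closed F → ∃ (IsCertificate F 0ᴹ)
    certificate-exists c = let v , 0≤v , s = settled-exists c in
      partition⇒certificate (partition c 0≤v) (settled-suc c s)

  -- The environment stays fixed while the recursion consumes `ws`; `i` marks how far it has come.
  certificate-complete : ∀ F φ → Open φ → ∀ k ws i a e →
    (∀ j → e (i ℕ.+ j) ≡ prepend ws (drop k e) j) →
    IsCertificate (drop k e) F (evalT M e a) ws →
    (∀ y → ¬ Sat M (y ◂ drop k e) φ) →
    Sat M e (certificate F φ k (length ws) i a)
  certificate-complete F φ o k [] i a e h s ¬φ =
    from (Sat-atF M k a e (allSettled F) (allSettled-open F)) s ,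
    ¬φ (evalT M e a) ∘ to (Sat-atF M k a e φ o)
  certificate-complete F φ o k (w ∷ ws) i a e h (s , ss) ¬φ =
    from (Sat-sameSign M k a (var i) e F)
      (subst (λ w → Same (drop k e) F (evalT M e a) w) w≡ei s) ,
    ¬φ (evalT M e a) ∘ to (Sat-atF M k a e φ o) ,
    certificate-complete F φ o k ws (suc i) (var i `+ `1) e
      (λ j → trans (cong e (sym (ℕₚ.+-suc i j))) (h (suc j)))
      (subst (λ w → IsCertificate (drop k e) F (w +ᴹ 1ᴹ) ws) w≡ei ss) ¬φ
    where
    w≡ei : w ≡ e i
    w≡ei = trans (sym (h 0)) (cong e (ℕₚ.+-identityʳ i))

  -- Inheritance of ∀∃-sentences

  inherits-∃≥0 : ∀ φ → Open φ →
    (∀ ρ → ∃ λ y → 0ℤ ℤ.≤ y × Sat ℤ-str (y ◂ᶻ ρ) φ) → M ⊨ (`∃ φ)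
  inherits-∃≥0 φ o h ρ = decidable-stable em λ none →
    let F = towers (atoms φ)
        ws , cert = certificate-exists ρ (towers-closed (atoms φ))
        k = length ws
        e = prepend ws ρ
        drop≡ρ = drop-prepend ws ρ
    -- The number k of end points depends on `ρ`, yet for each k it is a universal statement that no
    -- certificate with k end points exists. It holds in ℤ by soundness, as φ has a witness there,
    -- and it fails in `M` if φ has none.
    in inherits (`¬ certificate F φ k k 0 `0) (certificate-open F φ k k 0 `0 o)
         (λ e s → let y , 0≤y , φy = h (drop k e) in
                  certificate-sound φ o k k 0 `0 e s y 0≤y φy)
         e (certificate-complete F φ o k ws 0 `0 e
             (λ j → cong (λ ρ → prepend ws ρ j) (sym drop≡ρ))
             (subst (λ ρ → IsCertificate ρ F 0ᴹ ws) (sym drop≡ρ) cert)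
             (subst (λ ρ → ∀ y → ¬ Sat M (y ◂ ρ) φ) (sym drop≡ρ) (λ y φy → none (y , φy))))

  inherits-∃ : Inherits∀∃ M
  inherits-∃ φ o h ρ = let y , s = inherits-∃≥0 ψ (o , substF-open _ φ o) ψ-true ρ in
    [ (λ φy → y , φy) , (λ φ-y → -ᴹ y , to (Sat-atF M 1 (`- var 0) (y ◂ ρ) φ o) φ-y) ]′ s
    where
    ψ : Formula
    ψ = φ `∨ atF 1 (`- var 0) φ
    ψ-true : ∀ ρ → ∃ λ y → 0ℤ ℤ.≤ y × Sat ℤ-str (y ◂ᶻ ρ) ψ
    ψ-true ρ with h ρ
    ... | y , φy with ℤₚ.≤-total 0ℤ y
    ...   | inj₁ 0≤y = y , 0≤y , inj₁ φy
    ...   | inj₂ y≤0 = ℤ.- y , ℤₚ.neg-mono-≤ y≤0 , inj₂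
      (from (Sat-atF ℤ-str 1 (`- var 0) ((ℤ.- y) ◂ᶻ ρ) φ o)
        (subst (λ z → Sat ℤ-str (z ◂ᶻ ρ) φ) (sym (ℤₚ.neg-involutive y)) φy))

theorem1p1 : ExcludedMiddle 0ℓ →
    (M : Structure) → (ModelOfT M → IsDOI M) × (IsDOI M → ModelOfT M)
theorem1p1 em M =
  modelOfT⇒DOI em M , λ doi → inherits∀∃⇒modelOfT M (inherits-∃ em M doi)
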